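{- The logics $\mathsf L(\mathfrak Y_2)$, $\mathsf L(\mathfrak Y_2+)$, $\mathsf L(\mathfrak Y_3)$ and $\mathsf L(\mathfrak Y_3+)$ have nullary unification.
   Context: A frame is a finite poset with a least element; $\mathsf L(\mathfrak F)$ is the set of intuitionistic formulas valid in all Kripke models over $\mathfrak F$. $\mathfrak Y_2$: elements $r,a,b,t,s$ with $r<a$, $r<b$, $a<t$, $b<t$, $b<s$ (and transitivity), $t,s$ maximal, no other relations. $\mathfrak Y_3$: elements $r,a,b,c,d$ with $r<a$, $r<b$, and each of $a,b$ below each of $c,d$ (and transitivity), $c,d$ maximal, no other relations. $\mathfrak F+$ denotes $\mathfrak F$ with a new top element added above all elements. Unification in a logic $\mathsf L$ is nullary if some $\mathsf L$-unifiable formula has no minimal (w.r.t. inclusion) complete set of unifiers, where a set $\Sigma$ of unifiers of $A$ is complete if every unifier $\mu$ of $A$ satisfies $\alpha\circ\varepsilon=_{\mathsf L}\mu$ for some $\varepsilon\in\Sigma$ and substitution $\alpha$. -}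

module Defs where

open import Data.Nat using (ℕ; zero; suc; _≡ᵇ_)
open import Data.Fin using (Fin; toℕ)
open import Data.Bool using (Bool; true; false; _∨_)
open import Data.Product using (Σ; _×_; _,_; ∃)
open import Data.Sum using (_⊎_)
open import Data.Empty using (⊥)
open import Data.Unit using (⊤)
open import Relation.Binary.PropositionalEquality using (_≡_)
open import Relation.Nullary using (¬_)
open import Level using (Level; 0ℓ) renaming (suc to lsuc)

infixr 6 _∧ᶠ_
infixr 5 _∨ᶠ_
infixr 4 _⇒_

data Fm : Set where
  var  : ℕ → Fm
  ⊥ᶠ   : Fm
  _∧ᶠ_ : Fm → Fm → Fm
  _∨ᶠ_ : Fm → Fm → Fm
  _⇒_  : Fm → Fm → Fm

_⇔_ : Fm → Fm → Fm
A ⇔ B = (A ⇒ B) ∧ᶠ (B ⇒ A)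

Occ : ℕ → Fm → Set
Occ x (var y)  = x ≡ y
Occ x ⊥ᶠ       = ⊥
Occ x (A ∧ᶠ B) = Occ x A ⊎ Occ x B
Occ x (A ∨ᶠ B) = Occ x A ⊎ Occ x B
Occ x (A ⇒ B)  = Occ x A ⊎ Occ x B

Subst : Set
Subst = ℕ → Fm

_[_] : Fm → Subst → Fm
var x    [ σ ] = σ x
⊥ᶠ       [ σ ] = ⊥ᶠ
(A ∧ᶠ B) [ σ ] = (A [ σ ]) ∧ᶠ (B [ σ ])
(A ∨ᶠ B) [ σ ] = (A [ σ ]) ∨ᶠ (B [ σ ])
(A ⇒ B)  [ σ ] = (A [ σ ]) ⇒ (B [ σ ])

_∘ˢ_ : Subst → Subst → Subst
(α ∘ˢ ε) x = ε x [ α ]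

record Frame : Set where
  field
    size : ℕ
    leq  : Fin size → Fin size → Bool

open Frame public

record Valuation (F : Frame) : Set where
  field
    val  : ℕ → Fin (size F) → Bool
    mono : ∀ p x y → leq F x y ≡ true → val p x ≡ true → val p y ≡ true

open Valuation public

forces : (F : Frame) → Valuation F → Fin (size F) → Fm → Set
forces F V x (var p)  = val V p x ≡ true
forces F V x ⊥ᶠ       = ⊥
forces F V x (A ∧ᶠ B) = forces F V x A × forces F V x B
forces F V x (A ∨ᶠ B) = forces F V x A ⊎ forces F V x B
forces F V x (A ⇒ B)  = ∀ y → leq F x y ≡ true → forces F V y A → forces F V y B

_∈L_ : Fm → Frame → Set
A ∈L F = ∀ (V : Valuation F) x → forces F V x A

module Unification (F : Frame) where

  Unifier : Fm → Subst → Set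
  Unifier A ε = (A [ ε ]) ∈L F

  Unifiable : Fm → Set
  Unifiable A = ∃ λ ε → Unifier A ε

  _≈[_]_ : Subst → Fm → Subst → Set
  σ ≈[ A ] τ = ∀ x → Occ x A → (σ x ⇔ τ x) ∈L F

  SubstSet : Set₁
  SubstSet = Subst → Set

  _⊆_ : SubstSet → SubstSet → Set
  S ⊆ T = ∀ ε → S ε → T ε

  Complete : Fm → SubstSet → Set
  Complete A S =
    (∀ ε → S ε → Unifier A ε) ×
    (∀ μ → Unifier A μ → Σ Subst λ ε → S ε × Σ Subst λ α → (α ∘ˢ ε) ≈[ A ] μ)

  MinimalComplete : Fm → SubstSet → Set₁
  MinimalComplete A S =
    Complete A S × (∀ (T : SubstSet) → T ⊆ S → Complete A T → S ⊆ T)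

  Nullary : Set₁
  Nullary = Σ Fm λ A → Unifiable A × ¬ (Σ SubstSet λ S → MinimalComplete A S)

Nullary : Frame → Set₁
Nullary F = Unification.Nullary F

-- Y₂ : r=0, a=1, b=2, t=3, s=4 ; r<a, r<b, a<t, b<t, b<s (transitively closed)
leqY₂ : ℕ → ℕ → Bool
leqY₂ 0 _ = true
leqY₂ 1 3 = true
leqY₂ 2 3 = true
leqY₂ 2 4 = true
leqY₂ x y = x ≡ᵇ y

𝔜₂ : Frame
𝔜₂ = record { size = 5 ; leq = λ x y → leqY₂ (toℕ x) (toℕ y) }

-- Y₃ : r=0, a=1, b=2, c=3, d=4 ; r<a, r<b, a<c, a<d, b<c, b<d (transitively closed)
leqY₃ : ℕ → ℕ → Bool
leqY₃ 0 _ = true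
leqY₃ 1 3 = true
leqY₃ 1 4 = true
leqY₃ 2 3 = true
leqY₃ 2 4 = true
leqY₃ x y = x ≡ᵇ y

𝔜₃ : Frame
𝔜₃ = record { size = 5 ; leq = λ x y → leqY₃ (toℕ x) (toℕ y) }

-- F+ : F with a new top element (represented by Fin.zero; old elements are Fin.suc)
leqPlus : (F : Frame) → Fin (suc (size F)) → Fin (suc (size F)) → Bool
leqPlus F _            Fin.zero     = true
leqPlus F Fin.zero     (Fin.suc y)  = false
leqPlus F (Fin.suc x)  (Fin.suc y)  = leq F x y

_+ᶠ : Frame → Frame
F +ᶠ = record { size = suc (size F) ; leq = leqPlus F }

{-# OPTIONS --safe #-}
module Submission where

-- The formula p ∨ q serves for all four frames. Its unifiers ν n have values p = (γ → δ) → δ and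
-- q = γ → δ, where δ = codes n holds at a point unless the propositions 1, …, n + 1 take different
-- values at two points t, s above it (maximal ones, or coatoms in F +ᶠ), and γ = common n says
-- that t and s share one of the propositions 2, …, n + 1. So a fork over t, s with different codes
-- is labelled "only p" or "only q", that is, ν n describes an edge-labelled graph on codes.
--
-- If ν n is an instance of a unifier ε in m variables and n > 2 ^ m, then two codes i ≠ j become
-- indistinguishable for ε. Gluing a fork where q fails and one where p fails along the identified
-- points and adding a root gives a model over F whose root refutes ε p ∨ ε q. Hence no unifier is
-- more general than all ν n.
--
-- On the other hand every unifier has, for every n, a common generalisation with ν n: a fresh
-- variable switches between the two, and p, q are forced at a point where both modes are visible
-- as soon as they are forced at the points above it which lie in one mode.

open import Defs
open import Data.Bool using (Bool; true; false; _∨_; if_then_else_)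
import Data.Bool.Properties as Bool
open import Data.Empty using (⊥; ⊥-elim)
open import Data.Fin using (Fin; zero; suc; toℕ; fromℕ<; #_; funToFin; finToFun)
open import Data.Fin.Properties using (all?; any?; pigeonhole; 2↔Bool; finToFun-funToFin; toℕ-fromℕ<; toℕ<n)
  renaming (_≟_ to _≟ᶠ_)
open import Data.Nat using (ℕ; zero; suc; _^_; _⊔_; _<_; _<?_; _+_) renaming (_≟_ to _≟ⁿ_)
import Data.Nat.Properties as ℕ
open import Data.Product using (Σ; ∃; ∃₂; _×_; _,_; proj₁; proj₂)
import Data.Sum as Sum
open import Data.Sum using (_⊎_; inj₁; inj₂; [_,_])
open import Function using (_∘_; id; Inverse)
open import Relation.Binary.PropositionalEquality using (_≡_; _≢_; refl; sym; trans; cong; cong₂; subst)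
open import Relation.Nullary using (¬_; Dec; yes; no; does; contradiction)
open import Relation.Nullary.Decidable using (True; toWitness; decidable-stable; dec-true; dec-false; ¬?; _×-dec_; _⊎-dec_; _→-dec_)

-- Logical equivalence and decidability

infix 2 _⟺_

_⟺_ : Set → Set → Set
P ⟺ Q = (P → Q) × (Q → P)

⟺-sym : ∀ {P Q} → P ⟺ Q → Q ⟺ P
⟺-sym (f , g) = g , f

⟺-trans : ∀ {P Q R} → P ⟺ Q → Q ⟺ R → P ⟺ R
⟺-trans (f , g) (h , k) = h ∘ f , g ∘ k

does⇒ : ∀ {P : Set} (P? : Dec P) → does P? ≡ true → P
does⇒ (yes p) _ = p

does-cong : ∀ {P Q : Set} (P? : Dec P) (Q? : Dec Q) → P ⟺ Q → does P? ≡ does Q?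
does-cong (yes p) Q? (f , g) = sym (dec-true Q? (f p))
does-cong (no ¬p) Q? (f , g) = sym (dec-false Q? (¬p ∘ g))

≡-true-cong : ∀ {b c : Bool} → b ≡ c → (b ≡ true) ⟺ (c ≡ true)
≡-true-cong refl = id , id

-- Formulas and substitutions

⊤ᶠ : Fm
⊤ᶠ = ⊥ᶠ ⇒ ⊥ᶠ

bound : Fm → ℕ
bound (var x)  = suc x
bound ⊥ᶠ       = 0
bound (A ∧ᶠ B) = bound A ⊔ bound B
bound (A ∨ᶠ B) = bound A ⊔ bound B
bound (A ⇒ B)  = bound A ⊔ bound B

AgreeBelow : ℕ → Subst → Subst → Set
AgreeBelow m σ τ = ∀ x → x < m → σ x ≡ τ x

agreeˡ : ∀ {m n σ τ} → AgreeBelow (m ⊔ n) σ τ → AgreeBelow m σ τ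
agreeˡ h x x<m = h x (ℕ.<-≤-trans x<m (ℕ.m≤m⊔n _ _))

agreeʳ : ∀ {m n σ τ} → AgreeBelow (m ⊔ n) σ τ → AgreeBelow n σ τ
agreeʳ {m} h x x<n = h x (ℕ.<-≤-trans x<n (ℕ.m≤n⊔m m _))

subst-cong : ∀ A {σ τ} → AgreeBelow (bound A) σ τ → A [ σ ] ≡ A [ τ ]
subst-cong (var x)  h = h x ℕ.≤-refl
subst-cong ⊥ᶠ       h = refl
subst-cong (A ∧ᶠ B) h = cong₂ _∧ᶠ_ (subst-cong A (agreeˡ h)) (subst-cong B (agreeʳ {bound A} h))
subst-cong (A ∨ᶠ B) h = cong₂ _∨ᶠ_ (subst-cong A (agreeˡ h)) (subst-cong B (agreeʳ {bound A} h))
subst-cong (A ⇒ B)  h = cong₂ _⇒_ (subst-cong A (agreeˡ h)) (subst-cong B (agreeʳ {bound A} h))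

subst-∘ : ∀ A {σ τ} → A [ σ ] [ τ ] ≡ A [ τ ∘ˢ σ ]
subst-∘ (var x)  = refl
subst-∘ ⊥ᶠ       = refl
subst-∘ (A ∧ᶠ B) = cong₂ _∧ᶠ_ (subst-∘ A) (subst-∘ B)
subst-∘ (A ∨ᶠ B) = cong₂ _∨ᶠ_ (subst-∘ A) (subst-∘ B)
subst-∘ (A ⇒ B)  = cong₂ _⇒_ (subst-∘ A) (subst-∘ B)

subst-id : ∀ A {σ} → (∀ x → σ x ≡ var x) → A [ σ ] ≡ A
subst-id (var x)  h = h x
subst-id ⊥ᶠ       h = refl
subst-id (A ∧ᶠ B) h = cong₂ _∧ᶠ_ (subst-id A h) (subst-id B h)
subst-id (A ∨ᶠ B) h = cong₂ _∨ᶠ_ (subst-id A h) (subst-id B h)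
subst-id (A ⇒ B)  h = cong₂ _⇒_ (subst-id A h) (subst-id B h)

-- Mixtures and the unifiers `ν n`

¬ᶠ_ : Fm → Fm
¬ᶠ A = A ⇒ ⊥ᶠ

shift : Subst
shift x = var (suc x)

instantiate₀ : Fm → Subst
instantiate₀ B zero    = B
instantiate₀ B (suc x) = var x

instantiate-shift : ∀ A B → A [ shift ] [ instantiate₀ B ] ≡ A
instantiate-shift A B = trans (subst-∘ A) (subst-id A λ _ → refl)

-- After `shift`, `var 0` is a free switch: `⊥ᶠ` for it gives back `σ`, and `⊤ᶠ` gives back `τ`. The
-- guards are negations, so points in different modes have no common upper bound.
mixture : Subst → Subst → Subst
mixture σ τ x = (¬ᶠ var 0 ⇒ σ x [ shift ]) ∧ᶠ (¬ᶠ ¬ᶠ var 0 ⇒ τ x [ shift ])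

-- Negation relative to var 0, which plays ⊥ in the frames F and the proposition "top" in the frames F +ᶠ.
∼_ : Fm → Fm
∼ A = A ⇒ var 0

weakEM : ℕ → Fm
weakEM x = ∼ var x ∨ᶠ ∼ ∼ var x

-- `var 1` counts here but not in `common`, so two codes can differ in it and still share a
-- position.
codes : ℕ → Fm
codes zero    = weakEM 1
codes (suc n) = codes n ∧ᶠ weakEM (2 + n)

common : ℕ → Fm
common zero    = ⊥ᶠ
common (suc n) = common n ∨ᶠ ∼ ∼ var (2 + n)

ν : ℕ → Subst
ν n zero    = (common n ⇒ codes n) ⇒ codes n
ν n (suc _) = common n ⇒ codes n

-- Order conditions on frames

module Points (F : Frame) where

  infix 4 _≤_ _≤?_

  Pt : Set
  Pt = Fin (size F)

  _≤_ : Pt → Pt → Set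
  x ≤ y = leq F x y ≡ true

  _≤?_ : ∀ x y → Dec (x ≤ y)
  x ≤? y = leq F x y Bool.≟ true

  Incomparable : Pt → Pt → Set
  Incomparable x y = ¬ x ≤ y × ¬ y ≤ x

  incomparable? : ∀ x y → Dec (Incomparable x y)
  incomparable? x y = ¬? (x ≤? y) ×-dec ¬? (y ≤? x)

  Branching : Pt → Set
  Branching y = ∃₂ λ v v′ → y ≤ v × y ≤ v′ × Incomparable v v′

  branching? : ∀ y → Dec (Branching y)
  branching? y = any? λ v → any? λ v′ → (y ≤? v) ×-dec (y ≤? v′) ×-dec incomparable? v v′

-- `branching-pairs` carries `common` from one fork to an incomparable one; `branching-compatible`
-- keeps the two modes of a mixture from clashing.
record Admissible (F : Frame) : Set where
  open Points F
  field
    ≤-refl  : ∀ x → x ≤ x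
    ≤-trans : ∀ x y z → x ≤ y → y ≤ z → x ≤ z
    branching-pairs : ∀ y y′ → Incomparable y y′ → Branching y′ →
      ∀ v v′ → y ≤ v → y ≤ v′ → Incomparable v v′ → ∀ w → y′ ≤ w → y ≤ w ⊎ w ≤ v
    branching-compatible : ∀ y x → Branching y → ∃ λ c → y ≤ c × x ≤ c

module _ (F : Frame) where
  open Points F

  admissible :
    {_ : True (all? λ x → x ≤? x)} →
    {_ : True (all? λ x → all? λ y → all? λ z → (x ≤? y) →-dec ((y ≤? z) →-dec (x ≤? z)))} →
    {_ : True (all? λ y → all? λ y′ → incomparable? y y′ →-dec (branching? y′ →-dec
      all? λ v → all? λ v′ → (y ≤? v) →-dec ((y ≤? v′) →-dec (incomparable? v v′ →-dec
      all? λ w → (y′ ≤? w) →-dec ((y ≤? w) ⊎-dec (w ≤? v))))))} →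
    {_ : True (all? λ y → all? λ x → branching? y →-dec any? λ c → (y ≤? c) ×-dec (x ≤? c))} →
    Admissible F
  admissible {a} {b} {c} {d} = record
    { ≤-refl = toWitness a ; ≤-trans = toWitness b
    ; branching-pairs = toWitness c ; branching-compatible = toWitness d }


-- Forcing, substitution and p-morphisms

module Semantics (F : Frame) (adm : Admissible F) where
  open Points F
  open Admissible adm

  forces? : ∀ V x A → Dec (forces F V x A)
  forces? V x (var p)  = val V p x Bool.≟ true
  forces? V x ⊥ᶠ       = no λ ()
  forces? V x (A ∧ᶠ B) = forces? V x A ×-dec forces? V x B
  forces? V x (A ∨ᶠ B) = forces? V x A ⊎-dec forces? V x B
  forces? V x (A ⇒ B)  = all? λ y → (x ≤? y) →-dec (forces? V y A →-dec forces? V y B)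

  persistent : ∀ V A {x y} → x ≤ y → forces F V x A → forces F V y A
  persistent V (var p)  x≤y h = mono V p _ _ x≤y h
  persistent V (A ∧ᶠ B) x≤y (h , k) = persistent V A x≤y h , persistent V B x≤y k
  persistent V (A ∨ᶠ B) x≤y (inj₁ h) = inj₁ (persistent V A x≤y h)
  persistent V (A ∨ᶠ B) x≤y (inj₂ h) = inj₂ (persistent V B x≤y h)
  persistent V (A ⇒ B)  x≤y h z y≤z = h z (≤-trans _ _ z x≤y y≤z)

  ⇒-fails : ∀ V A B {x} → ¬ forces F V x (A ⇒ B) →
            ∃ λ y → x ≤ y × forces F V y A × ¬ forces F V y B
  ⇒-fails V A B {x} h with any? (λ y → (x ≤? y) ×-dec forces? V y A ×-dec ¬? (forces? V y B))
  ... | yes w = w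
  ... | no ¬w = contradiction
    (λ y x≤y a → decidable-stable (forces? V y B) λ ¬b → ¬w (y , x≤y , a , ¬b)) h

  pull : Subst → Valuation F → Valuation F
  pull α V = record
    { val  = λ p x → does (forces? V x (α p))
    ; mono = λ p x y x≤y h → dec-true (forces? V y (α p))
               (persistent V (α p) x≤y (does⇒ (forces? V x (α p)) h)) }

  forces-pull : ∀ V α A x → forces F (pull α V) x A ⟺ forces F V x (A [ α ])
  forces-pull V α (var p)  x = does⇒ (forces? V x (α p)) , dec-true (forces? V x (α p))
  forces-pull V α ⊥ᶠ       x = id , id
  forces-pull V α (A ∧ᶠ B) x with forces-pull V α A x | forces-pull V α B x
  ... | f , f⁻ | g , g⁻ = (λ (a , b) → f a , g b) , λ (a , b) → f⁻ a , g⁻ b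
  forces-pull V α (A ∨ᶠ B) x with forces-pull V α A x | forces-pull V α B x
  ... | f , f⁻ | g , g⁻ = Sum.map f g , Sum.map f⁻ g⁻
  forces-pull V α (A ⇒ B)  x =
    (λ h y x≤y a → proj₁ (forces-pull V α B y) (h y x≤y (proj₂ (forces-pull V α A y) a))) ,
    (λ h y x≤y a → proj₂ (forces-pull V α B y) (h y x≤y (proj₁ (forces-pull V α A y) a)))

  subst-closed : ∀ A α → A ∈L F → (A [ α ]) ∈L F
  subst-closed A α h V x = proj₁ (forces-pull V α A x) (h (pull α V) x)

  module _ (f : Pt → Pt) (g : Pt)
    (forth : ∀ x → g ≤ x → ∀ y → x ≤ y → f x ≤ f y)
    (back  : ∀ x → g ≤ x → ∀ y → f x ≤ y → ∃ λ z → x ≤ z × f z ≡ y) where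

    -- `forth` and `back` make `f` a p-morphism on the cone of `g`, and forcing at a point depends
    -- only on its cone.
    forces-along : ∀ V V′ → (∀ p x → g ≤ x → val V p x ≡ val V′ p (f x)) →
                   ∀ A x → g ≤ x → forces F V x A ⟺ forces F V′ (f x) A
    forces-along V V′ h (var p)  x g≤x = ≡-true-cong (h p x g≤x)
    forces-along V V′ h ⊥ᶠ       x g≤x = id , id
    forces-along V V′ h (A ∧ᶠ B) x g≤x
      with forces-along V V′ h A x g≤x | forces-along V V′ h B x g≤x
    ... | i , i⁻ | j , j⁻ = (λ (a , b) → i a , j b) , λ (a , b) → i⁻ a , j⁻ b
    forces-along V V′ h (A ∨ᶠ B) x g≤x
      with forces-along V V′ h A x g≤x | forces-along V V′ h B x g≤x
    ... | i , i⁻ | j , j⁻ = Sum.map i j , Sum.map i⁻ j⁻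
    forces-along V V′ h (A ⇒ B)  x g≤x = to , from
      where
      up : ∀ {z} → x ≤ z → g ≤ z
      up = ≤-trans g x _ g≤x

      to : forces F V x (A ⇒ B) → forces F V′ (f x) (A ⇒ B)
      to k y fx≤y a with back x g≤x y fx≤y
      ... | z , x≤z , refl =
        proj₁ (forces-along V V′ h B z (up x≤z)) (k z x≤z (proj₂ (forces-along V V′ h A z (up x≤z)) a))

      from : forces F V′ (f x) (A ⇒ B) → forces F V x (A ⇒ B)
      from k y x≤y a =
        proj₂ (forces-along V V′ h B y (up x≤y))
          (k (f y) (forth x g≤x y x≤y) (proj₁ (forces-along V V′ h A y (up x≤y)) a))

  forces-above : ∀ V V′ g → (∀ p x → g ≤ x → val V p x ≡ val V′ p x) →
                 ∀ A x → g ≤ x → forces F V x A ⟺ forces F V′ x A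
  forces-above V V′ g = forces-along id g (λ _ _ _ → id) (λ _ _ y x≤y → y , x≤y , refl) V V′

  -- The substitutions `ν n` are unifiers

  module _ (V : Valuation F) where

    infix 4 _⊩_

    _⊩_ : Pt → Fm → Set
    x ⊩ A = forces F V x A

    -- With `var 0` read as falsum, `v` and `v′` are incompatible points above `y`.
    Split : Pt → Set
    Split y = ∃₂ λ v v′ → y ≤ v × y ≤ v′ × ¬ v ⊩ var 0 × ¬ v′ ⊩ var 0 ×
              (∀ c → v ≤ c → v′ ≤ c → c ⊩ var 0)

    split-branching : ∀ {y} → Split y → Branching y
    split-branching (v , v′ , y≤v , y≤v′ , ¬u , ¬u′ , h) = v , v′ , y≤v , y≤v′ ,
      (λ v≤v′ → ¬u′ (h v′ v≤v′ (≤-refl v′))) , (λ v′≤v → ¬u (h v (≤-refl v) v′≤v))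

    -- One failing disjunct yields `v` forcing `var p`, the other `v′` forcing `∼ var p`; a common
    -- upper bound forces both, hence `var 0`.
    weakEM-fails : ∀ p {y} → ¬ y ⊩ weakEM p → Split y
    weakEM-fails p ¬d
      with ⇒-fails V (var p) (var 0) (¬d ∘ inj₁) | ⇒-fails V (∼ var p) (var 0) (¬d ∘ inj₂)
    ... | v , y≤v , vp , ¬u | v′ , y≤v′ , v′∼p , ¬u′ =
      v , v′ , y≤v , y≤v′ , ¬u , ¬u′ , λ c v≤c v′≤c → v′∼p c v′≤c (mono V p v c v≤c vp)

    codes-fails : ∀ n {y} → ¬ y ⊩ codes n → Split y
    codes-fails zero    ¬d = weakEM-fails 1 ¬d
    codes-fails (suc n) {y} ¬d with forces? V y (codes n)
    ... | yes d = weakEM-fails (2 + n) λ e → ¬d (d , e)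
    ... | no ¬d′ = codes-fails n ¬d′

    codes⇒ν : ∀ n i {y} → y ⊩ codes n → y ⊩ ν n i
    codes⇒ν n zero    d z y≤z _ = persistent V (codes n) y≤z d
    codes⇒ν n (suc i) d z y≤z _ = persistent V (codes n) y≤z d

    -- A point `w` above `y′` forcing `∼ var (2 + n)` lies above `y`, where the hypothesis applies,
    -- or below `v`; in the latter case `v` would force `var 0`.
    common-transfer : ∀ {y y′} → Incomparable y y′ → Branching y′ → Split y →
                      ∀ n → y ⊩ common n → y′ ⊩ common n
    common-transfer inc br sp (suc n) (inj₁ h) = inj₁ (common-transfer inc br sp n h)
    common-transfer {y} {y′} inc br sp@(v , v′ , y≤v , y≤v′ , ¬u , ¬u′ , _) (suc n) (inj₂ h) = inj₂ k
      where
      k : y′ ⊩ ∼ ∼ var (2 + n)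
      k w y′≤w w∼
        with branching-pairs y y′ inc br v v′ y≤v y≤v′ (proj₂ (proj₂ (proj₂ (proj₂ (split-branching sp))))) w y′≤w
      ... | inj₁ y≤w = h w y≤w w∼
      ... | inj₂ w≤v = ⊥-elim (¬u (h v y≤v (persistent V (∼ var (2 + n)) w≤v w∼)))

    -- Refuting both disjuncts gives `y` with `common` but not `codes`, and `y′` with
    -- `common n ⇒ codes n` but not `codes`. They are incomparable, so `common` transfers to `y′`
    -- and yields `codes` there.
    ν-valid : ∀ n x → x ⊩ ν n 0 ∨ᶠ ν n 1
    ν-valid n x with forces? V x (ν n 0) | forces? V x (ν n 1)
    ... | yes p | _ = inj₁ p
    ... | _ | yes q = inj₂ q
    ... | no ¬p | no ¬q
      with ⇒-fails V (common n) (codes n) ¬q | ⇒-fails V (common n ⇒ codes n) (codes n) ¬p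
    ... | y , _ , y-common , ¬d | y′ , _ , y′q , ¬d′ = ⊥-elim
      (¬d′ (y′q y′ (≤-refl y′) (common-transfer (y≰y′ , y′≰y)
        (split-branching (codes-fails n ¬d′)) (codes-fails n ¬d) n y-common)))
      where
      y≰y′ : ¬ y ≤ y′
      y≰y′ y≤y′ = ¬d′ (y′q y′ (≤-refl y′) (persistent V (common n) y≤y′ y-common))
      y′≰y : ¬ y′ ≤ y
      y′≰y y′≤y = ¬d (y′q y y′≤y y-common)

  -- Mixtures of unifiers and nullarity

  A₀ : Fm
  A₀ = var 0 ∨ᶠ var 1

  open Unification F hiding (Nullary)

  ν-unifier : ∀ n → Unifier A₀ (ν n)
  ν-unifier n V = ν-valid V n

  ν-shift-fails : ∀ V n i y → ¬ forces F V y (ν n i [ shift ]) → Branching y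
  ν-shift-fails V n i y h = split-branching (pull shift V) (codes-fails (pull shift V) n
    λ d → h (proj₁ (forces-pull V shift (ν n i) y) (codes⇒ν (pull shift V) n i d)))

  mixture-fails : ∀ V σ τ i {x} → ¬ forces F V x (mixture σ τ i) → ∃ λ y → x ≤ y ×
    ((forces F V y (¬ᶠ var 0) × ¬ forces F V y (σ i [ shift ])) ⊎
     (forces F V y (¬ᶠ ¬ᶠ var 0) × ¬ forces F V y (τ i [ shift ])))
  mixture-fails V σ τ i {x} h with forces? V x (¬ᶠ var 0 ⇒ σ i [ shift ])
  ... | no ¬k = let y , x≤y , m , ¬a = ⇒-fails V (¬ᶠ var 0) (σ i [ shift ]) ¬k in y , x≤y , inj₁ (m , ¬a)
  ... | yes k =
    let y , x≤y , m , ¬a = ⇒-fails V (¬ᶠ ¬ᶠ var 0) (τ i [ shift ]) (λ l → h (k , l)) in y , x≤y , inj₂ (m , ¬a)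

  disjunct-fails : ∀ {V A B} → (A ∨ᶠ B) ∈L F → ∀ {x y y′} → x ≤ y → x ≤ y′ →
                   ¬ forces F V y A → ¬ ¬ forces F V y′ B
  disjunct-fails {V} {A} {B} h {x} x≤y x≤y′ ¬a ¬b with h V x
  ... | inj₁ a = ¬a (persistent V A x≤y a)
  ... | inj₂ b = ¬b (persistent V B x≤y′ b)

  -- A point at which ν fails is branching, hence compatible with the points of the other mode.
  modes-clash : ∀ V n i {y y′} → forces F V y (¬ᶠ var 0) → forces F V y′ (¬ᶠ ¬ᶠ var 0) →
                ¬ ¬ forces F V y′ (ν n i [ shift ])
  modes-clash V n i {y} {y′} m m′ ¬a with branching-compatible y′ y (ν-shift-fails V n i y′ ¬a)
  ... | c , y′≤c , y≤c = m′ c y′≤c (persistent V (¬ᶠ var 0) y≤c m)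

  -- Each failing disjunct gives a point lying in one mode. Equal modes contradict `σ` or `ν n`
  -- being a unifier; different modes contradict `modes-clash`.
  mixture-unifier : ∀ σ n → Unifier A₀ σ → Unifier A₀ (mixture σ (ν n))
  mixture-unifier σ n h V x
    with forces? V x (mixture σ (ν n) 0) | forces? V x (mixture σ (ν n) 1)
  ... | yes a | _ = inj₁ a
  ... | _ | yes b = inj₂ b
  ... | no ¬a | no ¬b with mixture-fails V σ (ν n) 0 ¬a | mixture-fails V σ (ν n) 1 ¬b
  ... | y , x≤y , inj₁ (m , ¬p) | y′ , x≤y′ , inj₁ (m′ , ¬q) =
        ⊥-elim (disjunct-fails {V} (subst-closed (A₀ [ σ ]) shift h) x≤y x≤y′ ¬p ¬q)
  ... | y , x≤y , inj₂ (m , ¬p) | y′ , x≤y′ , inj₂ (m′ , ¬q) =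
        ⊥-elim (disjunct-fails {V} (subst-closed (A₀ [ ν n ]) shift (ν-unifier n)) x≤y x≤y′ ¬p ¬q)
  ... | y , x≤y , inj₁ (m , ¬p) | y′ , x≤y′ , inj₂ (m′ , ¬q) = ⊥-elim (modes-clash V n 1 m m′ ¬q)
  ... | y , x≤y , inj₂ (m , ¬p) | y′ , x≤y′ , inj₁ (m′ , ¬q) = ⊥-elim (modes-clash V n 0 m′ m ¬p)

  Instance : Subst → Subst → Set
  Instance σ τ = Σ Subst λ α → (α ∘ˢ σ) ≈[ A₀ ] τ

  Equivalent : Fm → Fm → Set
  Equivalent A B = ∀ V x → forces F V x A ⟺ forces F V x B

  ⇔-equivalent : ∀ {A B} → (A ⇔ B) ∈L F → Equivalent A B
  ⇔-equivalent h V x = proj₁ (h V x) x (≤-refl x) , proj₂ (h V x) x (≤-refl x)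

  equivalent-⇔ : ∀ {A B} → Equivalent A B → (A ⇔ B) ∈L F
  equivalent-⇔ h V x = (λ y _ → proj₁ (h V y)) , (λ y _ → proj₂ (h V y))

  instance-trans : ∀ {σ τ ρ} → Instance σ τ → Instance τ ρ → Instance σ ρ
  instance-trans {σ} {τ} {ρ} (α , h) (β , k) = (β ∘ˢ α) , λ x occ → equivalent-⇔ λ V y →
    ⟺-trans (subst (λ B → forces F V y B ⟺ forces F V y (τ x [ β ])) (subst-∘ (σ x))
      (⇔-equivalent (subst-closed ((σ x [ α ]) ⇔ τ x) β (h x occ)) V y))
      (⇔-equivalent (k x occ) V y)

  mixture-instanceˡ : ∀ σ τ → Instance (mixture σ τ) σ
  mixture-instanceˡ σ τ = instantiate₀ ⊥ᶠ , λ x _ → equivalent-⇔ λ V y →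
    (λ (h , _) → subst (forces F V y) (instantiate-shift (σ x) ⊥ᶠ) (h y (≤-refl y) λ _ _ ())) ,
    (λ h → (λ z y≤z _ → persistent V _ y≤z (subst (forces F V y) (sym (instantiate-shift (σ x) ⊥ᶠ)) h)) ,
           (λ z y≤z k → ⊥-elim (k z (≤-refl z) λ _ _ ())))

  mixture-instanceʳ : ∀ σ τ → Instance (mixture σ τ) τ
  mixture-instanceʳ σ τ = instantiate₀ ⊤ᶠ , λ x _ → equivalent-⇔ λ V y →
    (λ (_ , h) → subst (forces F V y) (instantiate-shift (τ x) ⊤ᶠ)
                   (h y (≤-refl y) λ z _ k → k z (≤-refl z) λ _ _ ())) ,
    (λ h → (λ z y≤z k → ⊥-elim (k z (≤-refl z) λ _ _ ())) ,
           (λ z y≤z _ → persistent V _ y≤z (subst (forces F V y) (sym (instantiate-shift (τ x) ⊤ᶠ)) h)))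

  -- Any unifier and ν n are instances of their mixture, so the members of a complete set
  -- that are more general than ν n form a complete set again; minimality would make every
  -- member more general than all ν n.
  nullary : (∀ ε → Unifier A₀ ε → ∃ λ n → ¬ Instance ε (ν n)) → Nullary F
  nullary bounded = A₀ , (ν 0 , ν-unifier 0) , λ (S , (unifiers , complete) , minimal) →
    let ε , ε∈S , _ = complete (ν 0) (ν-unifier 0)
        n , ¬inst   = bounded ε (unifiers ε ε∈S)
        T           = λ σ → S σ × Instance σ (ν n)
        T-complete  = (λ σ (σ∈S , _) → unifiers σ σ∈S) , λ μ h →
          let σ , σ∈S , inst = complete (mixture μ (ν n)) (mixture-unifier μ n h)
          in σ , (σ∈S , instance-trans {σ} {mixture μ (ν n)} inst (mixture-instanceʳ μ (ν n))) ,
             instance-trans {σ} {mixture μ (ν n)} inst (mixture-instanceˡ μ (ν n))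
    in ¬inst (proj₂ (minimal T (λ _ → proj₁) T-complete ε ε∈S))

-- Labelled forks

unit unit⁺ : ℕ → ℕ → Bool
-- The offset 2 skips `var 0`, the falsum, and the marker `var 1`.
unit i p = does (p ≟ⁿ 2 + i)
unit⁺ i p = does (p ≟ⁿ 1) ∨ does (p ≟ⁿ 2 + i)

unit-self : ∀ i → unit i (2 + i) ≡ true
unit-self i = dec-true (2 + i ≟ⁿ 2 + i) refl

unit-other : ∀ {i j} → j ≢ i → unit i (2 + j) ≡ false
unit-other {i} {j} j≢i = dec-false (2 + j ≟ⁿ 2 + i) (j≢i ∘ ℕ.suc-injective ∘ ℕ.suc-injective)

-- The flags say whether a point is above `t` and above `s`. A point above both, such as an added
-- top, makes everything true, including `var 0`.
select : Bool → Bool → Bool → Bool → Bool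
select true  true  _ _ = true
select true  false a _ = a
select false true  _ b = b
select false false _ _ = false

-- f₁ and g are forks over t and s. The map f sends the points above g to those above f₂, so that
-- a model above g is copied above f₂ while a model above f₁ is kept. In 𝔜₃ both a and b serve
-- as forks and f is the identity; in 𝔜₂ the fork b is folded onto a by identifying s with t.
record Configuration (F : Frame) : Set where
  open Points F
  field
    r t s f₁ f₂ g : Pt
    f             : Pt → Pt
    r≤f₁          : r ≤ f₁
    r≤f₂          : r ≤ f₂
    f₁≤t          : f₁ ≤ t
    f₁≤s          : f₁ ≤ s
    g≤t           : g ≤ t
    g≤s           : g ≤ s
    t∥s           : Incomparable t s
    f₁≰f₂         : ¬ f₁ ≤ f₂
    f-g           : f g ≡ f₂
    above-t       : ∀ x → t ≤ x → x ≡ t ⊎ s ≤ x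
    above-f₁      : ∀ x → f₁ ≤ x → x ≤ t ⊎ x ≤ s ⊎ (t ≤ x × s ≤ x)
    above-g       : ∀ x → g ≤ x → x ≡ g ⊎ t ≤ x ⊎ s ≤ x
    f-above-g     : ∀ x → g ≤ x → x ≡ g ⊎ f₁ ≤ f x
    f-forth       : ∀ x → g ≤ x → ∀ y → x ≤ y → f x ≤ f y
    f-back        : ∀ x → g ≤ x → ∀ y → f x ≤ y → ∃ λ z → x ≤ z × f z ≡ y
    f-kind        : (∀ x → f x ≡ x) ⊎
                    ((∀ x → t ≤ x → f x ≡ x) × (∀ x → s ≤ x → t ≤ f x × leq F s (f x) ≡ leq F t x))

module NoUniversalUnifier (F : Frame) (adm : Admissible F) (config : Configuration F) where
  open Points F
  open Admissible adm
  open Semantics F adm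
  open Unification F hiding (Nullary)
  open Configuration config

  t≤t : t ≤ t
  t≤t = ≤-refl t

  s≤s : s ≤ s
  s≤s = ≤-refl s

  forkVal : (T S : ℕ → Bool) → Valuation F
  forkVal T S = record { val = v ; mono = v-mono }
    where
    v : ℕ → Pt → Bool
    v p x = select (leq F t x) (leq F s x) (T p) (S p)

    v-mono : ∀ p x y → x ≤ y → v p x ≡ true → v p y ≡ true
    v-mono p x y x≤y h with leq F t x in t≤x | leq F s x in s≤x
    ... | true  | true  rewrite ≤-trans t x y t≤x x≤y | ≤-trans s x y s≤x x≤y = refl
    ... | true  | false rewrite ≤-trans t x y t≤x x≤y with leq F s y
    ...   | true  = refl
    ...   | false = h
    v-mono p x y x≤y h | false | true  rewrite ≤-trans s x y s≤x x≤y with leq F t y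
    ...   | true  = refl
    ...   | false = h
    v-mono p x y x≤y () | false | false

  forkVal-t : ∀ T S x → t ≤ x →
              (∀ p → val (forkVal T S) p x ≡ T p) ⊎ (∀ p → val (forkVal T S) p x ≡ true)
  forkVal-t T S x t≤x rewrite t≤x with leq F s x
  ... | true  = inj₂ λ _ → refl
  ... | false = inj₁ λ _ → refl

  forkVal-s : ∀ T S x → s ≤ x →
              (∀ p → val (forkVal T S) p x ≡ S p) ⊎ (∀ p → val (forkVal T S) p x ≡ true)
  forkVal-s T S x s≤x rewrite s≤x with leq F t x
  ... | true  = inj₂ λ _ → refl
  ... | false = inj₁ λ _ → refl

  forkVal-top : ∀ T S x → t ≤ x → s ≤ x → ∀ p → val (forkVal T S) p x ≡ true
  forkVal-top T S x t≤x s≤x p rewrite t≤x | s≤x = refl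

  forkVal-at-t : ∀ T S p → val (forkVal T S) p t ≡ T p
  forkVal-at-t T S p rewrite t≤t | Bool.¬-not (proj₂ t∥s) = refl

  forkVal-at-s : ∀ T S p → val (forkVal T S) p s ≡ S p
  forkVal-at-s T S p rewrite s≤s | Bool.¬-not (proj₁ t∥s) = refl

  -- A point above `t` carries `T`, or is above `s` too and makes everything true; the label of `s`
  -- is invisible from it.
  forces-t : ∀ T S S′ A x → t ≤ x → forces F (forkVal T S) x A ⟺ forces F (forkVal T S′) x A
  forces-t T S S′ = forces-above (forkVal T S) (forkVal T S′) t same
    where
    same : ∀ p x → t ≤ x → val (forkVal T S) p x ≡ val (forkVal T S′) p x
    same p x t≤x rewrite t≤x with leq F s x
    ... | true  = refl
    ... | false = refl

  forces-s : ∀ T T′ S A x → s ≤ x → forces F (forkVal T S) x A ⟺ forces F (forkVal T′ S) x A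
  forces-s T T′ S = forces-above (forkVal T S) (forkVal T′ S) s same
    where
    same : ∀ p x → s ≤ x → val (forkVal T S) p x ≡ val (forkVal T′ S) p x
    same p x s≤x rewrite s≤x with leq F t x
    ... | true  = refl
    ... | false = refl

  -- Forcing in labelled fork models

  module Cone (V : Valuation F) (c : Pt) (C : ℕ → Bool) (C0 : C 0 ≡ false)
    (at-c  : ∀ p → val V p c ≡ C p)
    (above : ∀ x → c ≤ x → (∀ p → val V p x ≡ C p) ⊎ (∀ p → val V p x ≡ true)) where

    ∼-holds : ∀ p {y} → C p ≡ false → c ≤ y → forces F V y (∼ var p)
    ∼-holds p {y} Cp c≤y z y≤z zp with above z (≤-trans c y z c≤y y≤z)
    ... | inj₂ all-true = all-true 0
    ... | inj₁ h with () ← trans (sym zp) (trans (h p) Cp)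

    ∼∼-holds : ∀ p {y} → C p ≡ true → c ≤ y → forces F V y (∼ ∼ var p)
    ∼∼-holds p {y} Cp c≤y z y≤z z∼ with above z (≤-trans c y z c≤y y≤z)
    ... | inj₂ all-true = all-true 0
    ... | inj₁ h = z∼ z (≤-refl z) (trans (h p) Cp)

    -- Points above `c` carry the same label `C` or force `var 0`, so relative to `var 0` the cone
    -- behaves classically.
    weakEM-holds : ∀ p {y} → c ≤ y → forces F V y (weakEM p)
    weakEM-holds p c≤y with C p in eq
    ... | true  = inj₂ (∼∼-holds p eq c≤y)
    ... | false = inj₁ (∼-holds p eq c≤y)

    codes-hold : ∀ n {y} → c ≤ y → forces F V y (codes n)
    codes-hold zero    c≤y = weakEM-holds 1 c≤y
    codes-hold (suc n) c≤y = codes-hold n c≤y , weakEM-holds (2 + n) c≤y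

    var0-fails : ¬ forces F V c (var 0)
    var0-fails h with () ← trans (sym h) (trans (at-c 0) C0)

    ∼-fails : ∀ p {y} → C p ≡ true → y ≤ c → ¬ forces F V y (∼ var p)
    ∼-fails p Cp y≤c h = var0-fails (h c y≤c (trans (at-c p) Cp))

    ∼∼-fails : ∀ p {y} → C p ≡ false → y ≤ c → ¬ forces F V y (∼ ∼ var p)
    ∼∼-fails p Cp y≤c h = var0-fails (h c y≤c (∼-holds p Cp (≤-refl c)))

  codes⇒weakEM-1 : ∀ V n {x} → forces F V x (codes n) → forces F V x (weakEM 1)
  codes⇒weakEM-1 V zero    h       = h
  codes⇒weakEM-1 V (suc n) (h , _) = codes⇒weakEM-1 V n h

  codes⇒weakEM : ∀ V n {i x} → i < n → forces F V x (codes n) → forces F V x (weakEM (2 + i))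
  codes⇒weakEM V (suc n) {i} i<1+n (h , k) with ℕ.m<1+n⇒m<n∨m≡n i<1+n
  ... | inj₁ i<n  = codes⇒weakEM V n i<n h
  ... | inj₂ refl = k

  common-intro : ∀ V n {i x} → i < n → forces F V x (∼ ∼ var (2 + i)) → forces F V x (common n)
  common-intro V (suc n) {i} i<1+n h with ℕ.m<1+n⇒m<n∨m≡n i<1+n
  ... | inj₁ i<n  = inj₁ (common-intro V n i<n h)
  ... | inj₂ refl = inj₂ h

  module ForkVal (T S : ℕ → Bool) (T0 : T 0 ≡ false) (S0 : S 0 ≡ false) where

    V : Valuation F
    V = forkVal T S

    module CT = Cone V t T T0 (forkVal-at-t T S) (forkVal-t T S)
    module CS = Cone V s S S0 (forkVal-at-s T S) (forkVal-s T S)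

    weakEM-failsᵗˢ : ∀ p {y} → y ≤ t → y ≤ s → T p ≡ true → S p ≡ false → ¬ forces F V y (weakEM p)
    weakEM-failsᵗˢ p y≤t y≤s Tp Sp (inj₁ h) = CT.∼-fails p Tp y≤t h
    weakEM-failsᵗˢ p y≤t y≤s Tp Sp (inj₂ h) = CS.∼∼-fails p Sp y≤s h

    weakEM-failsˢᵗ : ∀ p {y} → y ≤ t → y ≤ s → T p ≡ false → S p ≡ true → ¬ forces F V y (weakEM p)
    weakEM-failsˢᵗ p y≤t y≤s Tp Sp (inj₁ h) = CS.∼-fails p Sp y≤s h
    weakEM-failsˢᵗ p y≤t y≤s Tp Sp (inj₂ h) = CT.∼∼-fails p Tp y≤t h

    common-fails : ∀ n → (∀ l → T (2 + l) ≡ false ⊎ S (2 + l) ≡ false) → ¬ forces F V g (common n)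
    common-fails (suc n) h (inj₁ k) = common-fails n h k
    common-fails (suc n) h (inj₂ k) with h n
    ... | inj₁ Tn = CT.∼∼-fails (2 + n) Tn g≤t k
    ... | inj₂ Sn = CS.∼∼-fails (2 + n) Sn g≤s k

    -- Disjoint labels refute `common` at `g`, and all other points above `g` lie in a cone where
    -- `codes` holds. So `g` forces `common n ⇒ codes n` without `codes n`.
    ν₀-fails : ∀ n → (∀ l → T (2 + l) ≡ false ⊎ S (2 + l) ≡ false) → ¬ forces F V g (codes n) →
               ¬ forces F V g (ν n 0)
    ν₀-fails n disjoint ¬codes h = ¬codes (h g (≤-refl g) common⇒codes)
      where
      common⇒codes : forces F V g (common n ⇒ codes n)
      common⇒codes y g≤y k with above-g y g≤y
      ... | inj₁ refl        = ⊥-elim (common-fails n disjoint k)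
      ... | inj₂ (inj₁ t≤y) = CT.codes-hold n t≤y
      ... | inj₂ (inj₂ s≤y) = CS.codes-hold n s≤y

    ∼∼-fork : ∀ p → T p ≡ true → S p ≡ true → forces F V f₁ (∼ ∼ var p)
    ∼∼-fork p Tp Sp y f₁≤y y∼ with above-f₁ y f₁≤y
    ... | inj₁ y≤t                = ⊥-elim (CT.∼-fails p Tp y≤t y∼)
    ... | inj₂ (inj₁ y≤s)         = ⊥-elim (CS.∼-fails p Sp y≤s y∼)
    ... | inj₂ (inj₂ (t≤y , s≤y)) = forkVal-top T S y t≤y s≤y 0

  -- The labels share position `2 + i`, giving `common`, and differ at `var 1`, refuting `codes`.
  ν₁-fails : ∀ n i → i < n → ¬ forces F (forkVal (unit i) (unit⁺ i)) f₁ (ν n 1)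
  ν₁-fails n i i<n h = weakEM-failsˢᵗ 1 f₁≤t f₁≤s refl refl
    (codes⇒weakEM-1 V n (h f₁ (≤-refl f₁)
      (common-intro V n i<n (∼∼-fork (2 + i) (unit-self i) (unit-self i)))))
    where open ForkVal (unit i) (unit⁺ i) refl refl

  ν₀-fails-fixed : ∀ n i j → i ≢ j → ¬ forces F (forkVal (unit j) (unit⁺ i)) g (ν n 0)
  ν₀-fails-fixed n i j i≢j = ν₀-fails n disjoint
    λ h → weakEM-failsˢᵗ 1 g≤t g≤s refl refl (codes⇒weakEM-1 V n h)
    where
    open ForkVal (unit j) (unit⁺ i) refl refl
    disjoint : ∀ l → unit j (2 + l) ≡ false ⊎ unit⁺ i (2 + l) ≡ false
    disjoint l with l ≟ⁿ i
    ... | yes refl = inj₁ (unit-other i≢j)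
    ... | no l≢i   = inj₂ (unit-other l≢i)

  ν₀-fails-folded : ∀ n i j → i ≢ j → i < n → ¬ forces F (forkVal (unit i) (unit j)) g (ν n 0)
  ν₀-fails-folded n i j i≢j i<n = ν₀-fails n disjoint
    λ h → weakEM-failsᵗˢ (2 + i) g≤t g≤s (unit-self i) (unit-other i≢j) (codes⇒weakEM V n i<n h)
    where
    open ForkVal (unit i) (unit j) refl refl
    disjoint : ∀ l → unit i (2 + l) ≡ false ⊎ unit j (2 + l) ≡ false
    disjoint l with l ≟ⁿ i
    ... | yes refl = inj₂ (unit-other i≢j)
    ... | no l≢i   = inj₁ (unit-other l≢i)

  -- Gluing two fork models

  module Glue (U₁ U₂ : Valuation F)
    (agree : ∀ p x → g ≤ x → x ≢ g → val U₂ p x ≡ val U₁ p (f x)) where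

    -- By `f-back` and `f-above-g`, the only point above `f₂` and not above `f₁` is `f₂` itself, so
    -- the value of `U₂` at `g` suffices there.
    glueVal : ℕ → Pt → Bool
    glueVal p x = if leq F f₁ x then val U₁ p x else if leq F f₂ x then val U₂ p g else false

    glueVal₁ : ∀ p x → f₁ ≤ x → glueVal p x ≡ val U₁ p x
    glueVal₁ p x f₁≤x rewrite f₁≤x = refl

    glueVal₂ : ∀ p x → ¬ f₁ ≤ x → f₂ ≤ x → glueVal p x ≡ val U₂ p g
    glueVal₂ p x f₁≰x f₂≤x rewrite Bool.¬-not f₁≰x | f₂≤x = refl

    -- Monotonicity across the seam: `x` is the image of some `z` above `g`, and `z` is not `g`
    -- because `f₂` is not above `f₁`, so the models agree at `z`.
    transport : ∀ p x → f₁ ≤ x → f₂ ≤ x → val U₂ p g ≡ true → val U₁ p x ≡ true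
    transport p x f₁≤x f₂≤x h with f-back g (≤-refl g) x (subst (_≤ x) (sym f-g) f₂≤x)
    ... | z , g≤z , refl = trans (sym (agree p z g≤z z≢g)) (mono U₂ p g z g≤z h)
      where
      z≢g : z ≢ g
      z≢g refl = f₁≰f₂ (subst (f₁ ≤_) f-g f₁≤x)

    glue : Valuation F
    glue = record { val = glueVal ; mono = glue-mono }
      where
      glue-mono : ∀ p x y → x ≤ y → glueVal p x ≡ true → glueVal p y ≡ true
      glue-mono p x y x≤y h with leq F f₁ x in f₁≤x
      ... | true = trans (glueVal₁ p y (≤-trans f₁ x y f₁≤x x≤y)) (mono U₁ p x y x≤y h)
      ... | false with leq F f₂ x in f₂≤x
      ...   | true with f₁ ≤? y
      ...     | yes f₁≤y = trans (glueVal₁ p y f₁≤y) (transport p y f₁≤y (≤-trans f₂ x y f₂≤x x≤y) h)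
      ...     | no f₁≰y  = trans (glueVal₂ p y f₁≰y (≤-trans f₂ x y f₂≤x x≤y)) h

    glue-f₁ : ∀ A → forces F glue f₁ A ⟺ forces F U₁ f₁ A
    glue-f₁ A = forces-above glue U₁ f₁ glueVal₁ A f₁ (≤-refl f₁)

    glue-f₂ : ∀ A → forces F glue f₂ A ⟺ forces F U₂ g A
    glue-f₂ A = subst (λ x → forces F glue x A ⟺ forces F U₂ g A) f-g
      (⟺-sym (forces-along f g f-forth f-back U₂ glue same A g (≤-refl g)))
      where
      same : ∀ p x → g ≤ x → val U₂ p x ≡ glueVal p (f x)
      same p x g≤x with x ≟ᶠ g
      ... | yes refl = sym (trans (cong (glueVal p) f-g) (glueVal₂ p f₂ f₁≰f₂ (≤-refl f₂)))
      ... | no x≢g with f-above-g x g≤x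
      ...   | inj₁ x≡g = contradiction x≡g x≢g
      ...   | inj₂ f₁≤fx = trans (agree p x g≤x x≢g) (sym (glueVal₁ p (f x) f₁≤fx))

    unifier-clash : ∀ {A B} → (A ∨ᶠ B) ∈L F → ¬ forces F U₂ g A → ¬ ¬ forces F U₁ f₁ B
    unifier-clash {A} {B} h ¬a ¬b = disjunct-fails {glue} h r≤f₂ r≤f₁
      (¬a ∘ proj₁ (glue-f₂ A)) (¬b ∘ proj₁ (glue-f₁ B))

  -- Folding moves the cone of `s` into that of `t`, so the label `S` is read at `t` instead.
  forces-collapse : (∀ x → s ≤ x → t ≤ f x × leq F s (f x) ≡ leq F t x) →
    ∀ T S S′ A x → s ≤ x → forces F (forkVal T S) x A ⟺ forces F (forkVal S S′) (f x) A
  forces-collapse f-s T S S′ = forces-along f s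
    (λ x s≤x → f-forth x (≤-trans g s x g≤s s≤x))
    (λ x s≤x → f-back x (≤-trans g s x g≤s s≤x)) (forkVal T S) (forkVal S S′) same
    where
    same : ∀ p x → s ≤ x → val (forkVal T S) p x ≡ val (forkVal S S′) p (f x)
    same p x s≤x with f-s x s≤x
    ... | t≤fx , eq rewrite s≤x | t≤fx | eq with leq F t x
    ...   | true  = refl
    ...   | false = refl

  -- Pigeonhole on codes and the contradiction

  truncate : ℕ → Subst → Subst
  truncate m α x with x <? m
  ... | yes _ = α x
  -- With a constant default, only the first `m` formulas can tell two codes apart.
  ... | no  _ = ⊥ᶠ

  truncate-agrees : ∀ m α → AgreeBelow m α (truncate m α)
  truncate-agrees m α x x<m with x <? m
  ... | yes _  = refl
  ... | no x≮m = contradiction x<m x≮m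

  -- The label of `s` is immaterial here by `forces-t`.
  SameCode : Subst → ℕ → ℕ → Set
  SameCode α i j = ∀ p → forces F (forkVal (unit i) (unit i)) t (α p) ⟺ forces F (forkVal (unit j) (unit j)) t (α p)

  sameCode-above-t : ∀ {α i j} → SameCode α i j → ∀ S p x → t ≤ x →
    forces F (forkVal (unit i) S) x (α p) ⟺ forces F (forkVal (unit j) S) x (α p)
  sameCode-above-t {α} {i} {j} same S p x t≤x with above-t x t≤x
  ... | inj₂ s≤x  = forces-s (unit i) (unit j) S (α p) x s≤x
  ... | inj₁ refl = ⟺-trans (forces-t (unit i) S (unit i) (α p) t t≤t)
                   (⟺-trans (same p) (forces-t (unit j) (unit j) S (α p) t t≤t))

  code : Subst → ℕ → ℕ → Bool
  code α i p = does (forces? (forkVal (unit i) (unit i)) t (α p))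

  -- At `t`, `m` formulas have at most `2 ^ m` truth vectors, one fewer than the codes considered.
  sameCode-exists : ∀ m α → ∃₂ λ i j → i ≢ j × i < suc (2 ^ m) × SameCode (truncate m α) i j
  sameCode-exists m α with pigeonhole (ℕ.n<1+n (2 ^ m)) (funToFin ∘ bits)
    where
    bits : Fin (suc (2 ^ m)) → Fin m → Fin 2
    bits i = Inverse.from 2↔Bool ∘ code α (toℕ i) ∘ toℕ
  ... | i , j , i<j , eq = toℕ i , toℕ j , ℕ.<⇒≢ i<j , toℕ<n i , same
    where
    code-eq : ∀ k → code α (toℕ i) (toℕ {m} k) ≡ code α (toℕ j) (toℕ k)
    code-eq k = trans (sym (Inverse.strictlyInverseˡ 2↔Bool _)) (trans (cong (Inverse.to 2↔Bool)
      (trans (sym (finToFun-funToFin _ k)) (trans (cong (λ c → finToFun c k) eq) (finToFun-funToFin _ k))))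
      (Inverse.strictlyInverseˡ 2↔Bool _))

    same : SameCode (truncate m α) (toℕ i) (toℕ j)
    same p with p <? m
    ... | no _    = (λ ()) , λ ()
    ... | yes p<m = (λ h → does⇒ (forces? _ t _) (trans (sym eqₚ) (dec-true (forces? _ t _) h))) ,
                    (λ h → does⇒ (forces? _ t _) (trans eqₚ (dec-true (forces? _ t _) h)))
      where
      eqₚ : code α (toℕ i) p ≡ code α (toℕ j) p
      eqₚ = subst (λ q → code α (toℕ i) q ≡ code α (toℕ j) q) (toℕ-fromℕ< p<m) (code-eq (fromℕ< p<m))

  module _ (ε : Subst) (ε-unifier : Unifier A₀ ε) where

    m : ℕ
    m = bound (ε 0) ⊔ bound (ε 1)

    -- All variables of `ε 0` and `ε 1` are below `m`, so `α` may be truncated there. Two codes then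
    -- look alike to `ε`, which lets the pulled-back models be glued.
    not-instance : ¬ Instance ε (ν (suc (2 ^ m)))
    not-instance (α , α∘ε≈ν) with sameCode-exists m α
    ... | i , j , i≢j , i<n , same = [ fixed , folded ] f-kind
      where
      α′ = truncate m α
      n = suc (2 ^ m)

      V₁ : Valuation F
      V₁ = forkVal (unit i) (unit⁺ i)

      ε₀-fails : ∀ V → ¬ forces F V g (ν n 0) → ¬ forces F (pull α′ V) g (ε 0)
      ε₀-fails V ¬ν₀ h = ¬ν₀ (proj₁ (⇔-equivalent (α∘ε≈ν 0 (inj₁ refl)) V g)
        (subst (forces F V g) (sym (subst-cong (ε 0) (agreeˡ (truncate-agrees m α))))
          (proj₁ (forces-pull V α′ (ε 0) g) h)))

      ε₁-fails : ∀ V → ¬ forces F V f₁ (ν n 1) → ¬ forces F (pull α′ V) f₁ (ε 1)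
      ε₁-fails V ¬ν₁ h = ¬ν₁ (proj₁ (⇔-equivalent (α∘ε≈ν 1 (inj₂ refl)) V f₁)
        (subst (forces F V f₁) (sym (subst-cong (ε 1) (agreeʳ {bound (ε 0)} (truncate-agrees m α))))
          (proj₁ (forces-pull V α′ (ε 1) f₁) h)))

      clash : ∀ V₂ → ¬ forces F V₂ g (ν n 0) →
        (∀ p x → t ≤ x → forces F V₂ x (α′ p) ⟺ forces F V₁ (f x) (α′ p)) →
        (∀ p x → s ≤ x → forces F V₂ x (α′ p) ⟺ forces F V₁ (f x) (α′ p)) → ⊥
      clash V₂ ¬ν₀ above-t above-s =
        Glue.unifier-clash (pull α′ V₁) (pull α′ V₂) agree ε-unifier
          (ε₀-fails V₂ ¬ν₀) (ε₁-fails V₁ (ν₁-fails n i i<n))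
        where
        agree : ∀ p x → g ≤ x → x ≢ g → val (pull α′ V₂) p x ≡ val (pull α′ V₁) p (f x)
        agree p x g≤x x≢g with above-g x g≤x
        ... | inj₁ x≡g        = contradiction x≡g x≢g
        ... | inj₂ (inj₁ t≤x) = does-cong (forces? V₂ x (α′ p)) (forces? V₁ (f x) (α′ p)) (above-t p x t≤x)
        ... | inj₂ (inj₂ s≤x) = does-cong (forces? V₂ x (α′ p)) (forces? V₁ (f x) (α′ p)) (above-s p x s≤x)

      -- Passing from `V₁` to `V₂` only replaces `unit i` by the indistinguishable `unit j` at `t`.
      fixed : ¬ (∀ x → f x ≡ x)
      fixed f-id = clash V₂ (ν₀-fails-fixed n i j i≢j)
        (λ p x t≤x → subst (λ y → forces F V₂ x (α′ p) ⟺ forces F V₁ y (α′ p)) (sym (f-id x))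
          (⟺-sym (sameCode-above-t {α′} {i} {j} same (unit⁺ i) p x t≤x)))
        (λ p x s≤x → subst (λ y → forces F V₂ x (α′ p) ⟺ forces F V₁ y (α′ p)) (sym (f-id x))
          (forces-s (unit j) (unit i) (unit⁺ i) (α′ p) x s≤x))
        where
        V₂ : Valuation F
        V₂ = forkVal (unit j) (unit⁺ i)

      -- `V₂` has `unit i` at `t`, as `V₁` does, and `unit j` at `s`; folding puts the latter onto
      -- `t`, where it cannot be told from `unit i`.
      folded : ¬ ((∀ x → t ≤ x → f x ≡ x) × (∀ x → s ≤ x → t ≤ f x × leq F s (f x) ≡ leq F t x))
      folded (f-t , f-s) = clash V₂ (ν₀-fails-folded n i j i≢j i<n)
        (λ p x t≤x → subst (λ y → forces F V₂ x (α′ p) ⟺ forces F V₁ y (α′ p)) (sym (f-t x t≤x))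
          (forces-t (unit i) (unit j) (unit⁺ i) (α′ p) x t≤x))
        (λ p x s≤x → ⟺-trans (forces-collapse f-s (unit i) (unit j) (unit⁺ i) (α′ p) x s≤x)
          (⟺-sym (sameCode-above-t {α′} {i} {j} same (unit⁺ i) p (f x) (proj₁ (f-s x s≤x)))))
        where
        V₂ : Valuation F
        V₂ = forkVal (unit i) (unit j)

  unification-nullary : Nullary F
  unification-nullary = nullary λ ε h → suc (2 ^ m ε h) , not-instance ε h

-- The four frames

module _ (F : Frame) (adm : Admissible F) where
  open Points F

  -- Every condition quantifies over a finite frame, so it is discharged by evaluating its decision
  -- procedure.
  nullary-by-configuration : (r t s f₁ f₂ g : Pt) (f : Pt → Pt) →
    {_ : True ((r ≤? f₁) ×-dec (r ≤? f₂) ×-dec (f₁ ≤? t) ×-dec (f₁ ≤? s) ×-dec (g ≤? t) ×-dec (g ≤? s) ×-dec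
               incomparable? t s ×-dec ¬? (f₁ ≤? f₂) ×-dec (f g ≟ᶠ f₂))} →
    {_ : True (all? λ x → (t ≤? x) →-dec ((x ≟ᶠ t) ⊎-dec (s ≤? x)))} →
    {_ : True (all? λ x → (f₁ ≤? x) →-dec ((x ≤? t) ⊎-dec (x ≤? s) ⊎-dec ((t ≤? x) ×-dec (s ≤? x))))} →
    {_ : True (all? λ x → (g ≤? x) →-dec ((x ≟ᶠ g) ⊎-dec (t ≤? x) ⊎-dec (s ≤? x)))} →
    {_ : True (all? λ x → (g ≤? x) →-dec ((x ≟ᶠ g) ⊎-dec (f₁ ≤? f x)))} →
    {_ : True (all? λ x → (g ≤? x) →-dec all? λ y → (x ≤? y) →-dec (f x ≤? f y))} →
    {_ : True (all? λ x → (g ≤? x) →-dec all? λ y → (f x ≤? y) →-dec any? λ z → (x ≤? z) ×-dec (f z ≟ᶠ y))} →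
    {_ : True ((all? λ x → f x ≟ᶠ x) ⊎-dec
               ((all? λ x → (t ≤? x) →-dec (f x ≟ᶠ x)) ×-dec
                (all? λ x → (s ≤? x) →-dec ((t ≤? f x) ×-dec (leq F s (f x) Bool.≟ leq F t x)))))} →
    Nullary F
  nullary-by-configuration r t s f₁ f₂ g f {points} {a} {b} {c} {d} {e} {h} {k} =
    let r≤f₁ , r≤f₂ , f₁≤t , f₁≤s , g≤t , g≤s , t∥s , f₁≰f₂ , f-g = toWitness points
    in NoUniversalUnifier.unification-nullary F adm record
      { r = r ; t = t ; s = s ; f₁ = f₁ ; f₂ = f₂ ; g = g ; f = f
      ; r≤f₁ = r≤f₁ ; r≤f₂ = r≤f₂ ; f₁≤t = f₁≤t ; f₁≤s = f₁≤s ; g≤t = g≤t ; g≤s = g≤s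
      ; t∥s = t∥s ; f₁≰f₂ = f₁≰f₂ ; f-g = f-g
      ; above-t = toWitness a ; above-f₁ = toWitness b ; above-g = toWitness c
      ; f-above-g = toWitness d ; f-forth = toWitness e ; f-back = toWitness h ; f-kind = toWitness k }

fold : Fin 5 → Fin 5
fold (suc (suc zero))             = # 1
fold (suc (suc (suc (suc zero)))) = # 3
fold x                            = x

fold⁺ : Fin 6 → Fin 6
fold⁺ zero    = zero
fold⁺ (suc x) = suc (fold x)

theorem5p12 : Nullary 𝔜₂ × Nullary (𝔜₂ +ᶠ) × Nullary 𝔜₃ × Nullary (𝔜₃ +ᶠ)
theorem5p12 =
  -- In `𝔜₂` the point b is both `f₁` and `g`, and a is `f₂`; in `𝔜₃` a is `f₁`, and b is both `f₂`
  -- and `g`. The added top is 0, which shifts the indices by one.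
  nullary-by-configuration 𝔜₂ (admissible 𝔜₂) (# 0) (# 3) (# 4) (# 2) (# 1) (# 2) fold ,
  nullary-by-configuration (𝔜₂ +ᶠ) (admissible (𝔜₂ +ᶠ)) (# 1) (# 4) (# 5) (# 3) (# 2) (# 3) fold⁺ ,
  nullary-by-configuration 𝔜₃ (admissible 𝔜₃) (# 0) (# 3) (# 4) (# 1) (# 2) (# 2) id ,
  nullary-by-configuration (𝔜₃ +ᶠ) (admissible (𝔜₃ +ᶠ)) (# 1) (# 4) (# 5) (# 2) (# 3) (# 3) id
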